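{- Let $\Delta \ge 4$ be an integer, and let $c_1,\dots,c_\Delta$ be the real numbers defined by $c_\Delta=\frac{1}{\Delta}$ and $ic_{i}+c_{i+1}=1$ for $i=1,\dots,\Delta-1$. Let $\Delta'$ be an integer with $3\le \Delta'< \Delta$ and let $G\in \mathcal{G}_{\Delta'}$. Then $$\alpha(G)\ge \sum_{i=1}^{\Delta'} c_i|V_i(G)|.$$
   Context: All graphs are finite, simple and undirected. $\alpha(G)$ denotes the independence number of $G$. For an integer $D\ge 3$, $\mathcal{G}_{D}$ is the set of connected graphs $G\neq K_{D+1}$ with maximum degree $D$. For a graph $G$ and an integer $i\ge 1$, $V_i(G)$ denotes the set of vertices of $G$ of degree $i$. -}

module Defs where

open import Data.Nat as ℕ using (ℕ; zero; suc; _∸_; _≡ᵇ_; _⊔_)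
open import Data.Bool using (Bool; true; false; _∧_; not; if_then_else_)
open import Data.Fin using (Fin)
open import Data.List using (List; []; _∷_; length; filterᵇ; allFin; map; concatMap; foldr)
open import Data.Vec using (Vec; []; _∷_; lookup)
open import Data.Integer using (+_)
open import Data.Rational using (ℚ; _/_; 0ℚ; 1ℚ; _+_; _*_; _-_)
open import Data.Product using (_×_; ∃)
open import Relation.Binary.PropositionalEquality using (_≡_; _≢_)
open import Relation.Nullary using (¬_)

record Graph : Set where
  field
    n      : ℕ
    adj    : Fin n → Fin n → Bool
    adj-sym    : ∀ u v → adj u v ≡ adj v u
    adj-irrefl : ∀ v → adj v v ≡ false
open Graph public

deg : (G : Graph) → Fin (n G) → ℕ
deg G v = length (filterᵇ (adj G v) (allFin (n G)))

numDeg : Graph → ℕ → ℕ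
numDeg G i = length (filterᵇ (λ v → deg G v ≡ᵇ i) (allFin (n G)))

data Reach (G : Graph) : Fin (n G) → Fin (n G) → Set where
  here : ∀ {v} → Reach G v v
  step : ∀ {u w v} → adj G u w ≡ true → Reach G w v → Reach G u v

Connected : Graph → Set
Connected G = ∀ u v → Reach G u v

MaxDegree : ℕ → Graph → Set
MaxDegree D G = (∀ v → deg G v ℕ.≤ D) × ∃ λ v → deg G v ≡ D

IsComplete : ℕ → Graph → Set
IsComplete m G = (n G ≡ m) × (∀ u v → u ≢ v → adj G u v ≡ true)

InClass : ℕ → Graph → Set
InClass D G = Connected G × MaxDegree D G × ¬ IsComplete (suc D) G

allᵇ : {A : Set} → (A → Bool) → List A → Bool
allᵇ p = foldr (λ x b → p x ∧ b) true

allSubsets : (k : ℕ) → List (Vec Bool k)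
allSubsets zero = [] ∷ []
allSubsets (suc k) = concatMap (λ S → (true ∷ S) ∷ (false ∷ S) ∷ []) (allSubsets k)

size : ∀ {k} → Vec Bool k → ℕ
size [] = 0
size (true ∷ S) = suc (size S)
size (false ∷ S) = size S

isIndependent : (G : Graph) → Vec Bool (n G) → Bool
isIndependent G S =
  allᵇ (λ u → allᵇ (λ v → not (lookup S u ∧ lookup S v ∧ adj G u v)) (allFin (n G))) (allFin (n G))

α : Graph → ℕ
α G = foldr _⊔_ 0 (map (λ S → if isIndependent G S then size S else 0) (allSubsets (n G)))

fromℕ : ℕ → ℚ
fromℕ m = + m / 1

-- 1/m for m ≥ 1 (value at 0 is never used)
inv : ℕ → ℚ
inv zero = 0ℚ
inv (suc m) = + 1 / suc m

-- cFrom Δ k = c_{Δ-k}, where c_Δ = 1/Δ and i c_i + c_{i+1} = 1, i.e. c_i = (1 - c_{i+1})/i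
cFrom : ℕ → ℕ → ℚ
cFrom Δ zero = inv Δ
cFrom Δ (suc k) = (1ℚ - cFrom Δ k) * inv (Δ ∸ suc k)

-- c Δ i = c_i  (meaningful for 1 ≤ i ≤ Δ)
c : ℕ → ℕ → ℚ
c Δ i = cFrom Δ (Δ ∸ i)

weightedSum : ℕ → ℕ → Graph → ℚ
weightedSum Δ zero G = 0ℚ
weightedSum Δ (suc m) G = weightedSum Δ m G + c Δ (suc m) * fromℕ (numDeg G (suc m))

{-# OPTIONS --safe #-}

-- Greedy deletion with weights c_{deg v}, degrees taken in G throughout.  If the remaining set S is proper,
-- or G is not regular, connectivity yields a vertex u of minimum degree m in G[S] whose closed neighbourhood
-- in G[S] contains a vertex of degree > m in G; that neighbourhood then weighs at most m c_m + c_{m+1} = 1, so u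
-- is put into the independent set and the neighbourhood is deleted.  In a D-regular graph the first step
-- may weigh (D + 1) c_D > 1, but when G is not complete a second step exists, and it removes at most
-- D vertices; together they weigh at most (2D + 1) c_D ≤ 2, because c_D ≤ 2 c_{D+1}.
module Submission where

open import Defs
open import Data.Nat using (ℕ; _≤_; _<_)
open import Data.Rational using () renaming (_≤_ to _≤ℚ_)

open import Data.Bool using (Bool; true; false; _∧_; _∨_; not; if_then_else_)
open import Data.Bool.Properties using (∧-zeroʳ; ∧-identityʳ; ∨-zeroʳ) renaming (_≟_ to _≟ᵇ_)
open import Data.Empty using (⊥-elim)
open import Data.Fin using (Fin; zero; suc; _≟_)
open import Data.Fin.Properties using (any?)
open import Data.Integer as ℤ using (+_)
import Data.Integer.Properties as ℤ
open import Data.List using (List; []; _∷_; length; filterᵇ; tabulate; allFin; foldr; map)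
open import Data.List.Membership.Propositional using (_∈_)
open import Data.List.Membership.Propositional.Properties using (∈-concatMap⁺)
open import Data.List.Relation.Unary.Any as Any using (here; there)
open import Data.Nat as ℕ using (zero; suc; z≤n; s≤s; _∸_; _≡ᵇ_; _≤ᵇ_)
import Data.Nat.Properties as ℕ
open import Data.Product using (_×_; _,_; proj₁; proj₂; ∃)
open import Data.Rational using (ℚ; 0ℚ; 1ℚ; _+_; _*_; _-_; -_; Positive; NonNegative; nonNegative; toℚᵘ)
import Data.Rational.Properties as ℚ
open import Data.Rational.Solver using (module +-*-Solver)
import Data.Rational.Unnormalised as ℚᵘ
import Data.Rational.Unnormalised.Properties as ℚᵘ
open import Data.Sum using (_⊎_; inj₁; inj₂)
open import Data.Vec as Vec using (Vec; []; _∷_; lookup)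
open import Data.Vec.Properties using (lookup∘tabulate)
open import Function using (_∘_)
open import Relation.Binary.PropositionalEquality using (_≡_; _≢_; refl; sym; trans; cong; cong₂; subst; subst₂)
open import Relation.Nullary using (yes; no; does; _×-dec_)
open import Relation.Nullary.Decidable using (dec-true; dec-false)
open import Algebra.Properties.CommutativeMonoid.Sum ℚ.+-0-commutativeMonoid using (sum; sum-cong-≗; ∑-distrib-+)

-- Rationals and the coefficients

-- `_/_` normalises by a gcd, so neither side computes. On unnormalised fractions the claim becomes
-- an integer identity.
fromℕ-+ : ∀ a b → fromℕ (a ℕ.+ b) ≡ fromℕ a + fromℕ b
fromℕ-+ a b = ℚ.toℚᵘ-injective (begin
  toℚᵘ (fromℕ (a ℕ.+ b))                  ≈⟨ ℚ.toℚᵘ-fromℚᵘ (ℚᵘ.mkℚᵘ (+ (a ℕ.+ b)) 0) ⟩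
  ℚᵘ.mkℚᵘ (+ (a ℕ.+ b)) 0                 ≈⟨ ℚᵘ.*≡* (cong₂ (λ x y → (x ℤ.+ y) ℤ.* + 1) (sym (ℤ.*-identityʳ (+ a))) (sym (ℤ.*-identityʳ (+ b)))) ⟩
  ℚᵘ.mkℚᵘ (+ a) 0 ℚᵘ.+ ℚᵘ.mkℚᵘ (+ b) 0    ≈⟨ ℚᵘ.+-cong (ℚ.toℚᵘ-fromℚᵘ (ℚᵘ.mkℚᵘ (+ a) 0)) (ℚ.toℚᵘ-fromℚᵘ (ℚᵘ.mkℚᵘ (+ b) 0)) ⟨
  toℚᵘ (fromℕ a) ℚᵘ.+ toℚᵘ (fromℕ b)      ≈⟨ ℚ.toℚᵘ-homo-+ (fromℕ a) (fromℕ b) ⟨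
  toℚᵘ (fromℕ a + fromℕ b)                ∎)
  where open ℚᵘ.≃-Reasoning

fromℕ-*-inv : ∀ i → fromℕ (suc i) * inv (suc i) ≡ 1ℚ
fromℕ-*-inv i = ℚ.toℚᵘ-injective (begin
  toℚᵘ (fromℕ (suc i) * inv (suc i))               ≈⟨ ℚ.toℚᵘ-homo-* (fromℕ (suc i)) (inv (suc i)) ⟩
  toℚᵘ (fromℕ (suc i)) ℚᵘ.* toℚᵘ (inv (suc i))      ≈⟨ ℚᵘ.*-cong (ℚ.toℚᵘ-fromℚᵘ (ℚᵘ.mkℚᵘ (+ suc i) 0)) (ℚ.toℚᵘ-fromℚᵘ (ℚᵘ.mkℚᵘ (+ 1) i)) ⟩
  ℚᵘ.mkℚᵘ (+ suc i) 0 ℚᵘ.* ℚᵘ.mkℚᵘ (+ 1) i          ≈⟨ ℚᵘ.*≡* (trans (ℤ.*-identityʳ _) (trans (ℤ.*-identityʳ (+ suc i)) (sym (trans (ℤ.*-identityˡ _) (ℤ.*-identityˡ (+ suc i)))))) ⟩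
  ℚᵘ.1ℚᵘ                                           ∎)
  where open ℚᵘ.≃-Reasoning

fromℕ-nonNeg : ∀ i → NonNegative (fromℕ i)
fromℕ-nonNeg i = ℚ.normalize-nonNeg i 1

fromℕ-pos : ∀ i → Positive (fromℕ (suc i))
fromℕ-pos i = ℚ.normalize-pos (suc i) 1

inv-nonNeg : ∀ i → NonNegative (inv i)
inv-nonNeg zero    = nonNegative ℚ.≤-refl
inv-nonNeg (suc i) = ℚ.normalize-nonNeg 1 (suc i)

0≤fromℕ : ∀ i → 0ℚ ≤ℚ fromℕ i
0≤fromℕ i = ℚ.nonNegative⁻¹ (fromℕ i) {{fromℕ-nonNeg i}}

p≤p+q : ∀ {p q} → 0ℚ ≤ℚ q → p ≤ℚ p + q
p≤p+q {p} {q} 0≤q = subst (_≤ℚ p + q) (ℚ.+-identityʳ p) (ℚ.+-monoʳ-≤ p {0ℚ} {q} 0≤q)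

fromℕ-mono : ∀ {a b} → a ≤ b → fromℕ a ≤ℚ fromℕ b
fromℕ-mono {a} {b} a≤b = subst (λ k → fromℕ a ≤ℚ fromℕ k) (ℕ.m+[n∸m]≡n a≤b)
  (subst (fromℕ a ≤ℚ_) (sym (fromℕ-+ a (b ∸ a))) (p≤p+q (0≤fromℕ (b ∸ a))))

fromℕ-suc-* : ∀ i q → fromℕ (suc i) * q ≡ fromℕ i * q + q
fromℕ-suc-* i q = trans (cong (_* q) (fromℕ-+ 1 i))
  (solve 2 (λ a b → (con 1ℚ :+ a) :* b := a :* b :+ b) refl (fromℕ i) q)
  where open +-*-Solver

+-cancelʳ-≤ : ∀ r {p q} → p + r ≤ℚ q + r → p ≤ℚ q
+-cancelʳ-≤ r {p} {q} h = subst₂ _≤ℚ_ (e p) (e q) (ℚ.+-monoˡ-≤ (- r) h)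
  where
  open +-*-Solver
  e : ∀ x → x + r + - r ≡ x
  e x = solve 2 (λ x r → x :+ r :+ (:- r) := x) refl x r

module Coefficients (Δ : ℕ) where

  open ℚ.≤-Reasoning

  -- `cFrom` counts downwards from `Δ`: `i < Δ` makes `Δ ∸ i` a successor, and `Δ ∸ (Δ ∸ i)` is `i`
  -- again.
  c-step : ∀ {i} → i < Δ → c Δ i ≡ (1ℚ - c Δ (suc i)) * inv i
  c-step {i} i<Δ = trans (cong (cFrom Δ) (sym e))
    (cong (λ k → (1ℚ - c Δ (suc i)) * inv k) (trans (cong (Δ ∸_) e) (ℕ.m∸[m∸n]≡n (ℕ.<⇒≤ i<Δ))))
    where
    e : suc (Δ ∸ suc i) ≡ Δ ∸ i
    e = sym (ℕ.+-∸-assoc 1 i<Δ)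

  c-last : c Δ Δ ≡ inv Δ
  c-last = cong (cFrom Δ) (ℕ.n∸n≡0 Δ)

  c-rec : ∀ {i} → suc i < Δ → fromℕ (suc i) * c Δ (suc i) + c Δ (suc (suc i)) ≡ 1ℚ
  c-rec {i} i<Δ = begin-equality
    f * c Δ (suc i) + c′            ≡⟨ cong (λ x → f * x + c′) (c-step i<Δ) ⟩
    f * ((1ℚ - c′) * v) + c′        ≡⟨ solve 3 (λ f v c → f :* ((con 1ℚ :+ (:- c)) :* v) :+ c := (f :* v) :* (con 1ℚ :+ (:- c)) :+ c) refl f v c′ ⟩
    (f * v) * (1ℚ - c′) + c′        ≡⟨ cong (λ x → x * (1ℚ - c′) + c′) (fromℕ-*-inv i) ⟩
    1ℚ * (1ℚ - c′) + c′             ≡⟨ solve 1 (λ c → con 1ℚ :* (con 1ℚ :+ (:- c)) :+ c := con 1ℚ) refl c′ ⟩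
    1ℚ                              ∎
    where
    open +-*-Solver
    f = fromℕ (suc i)
    v = inv (suc i)
    c′ = c Δ (suc (suc i))

  private
    ≤-from-multiple : ∀ {i q} → 0ℚ ≤ℚ q → fromℕ (suc i) * q ≤ℚ 1ℚ → q ≤ℚ 1ℚ
    ≤-from-multiple {i} {q} 0≤q h = begin
      q                    ≡⟨ ℚ.+-identityˡ q ⟨
      0ℚ + q               ≤⟨ ℚ.+-monoˡ-≤ q (ℚ.nonNegative⁻¹ (fromℕ i * q) {{ℚ.nonNeg*nonNeg⇒nonNeg (fromℕ i) {{fromℕ-nonNeg i}} q {{nonNegative 0≤q}}}}) ⟩
      fromℕ i * q + q      ≡⟨ fromℕ-suc-* i q ⟨
      fromℕ (suc i) * q    ≤⟨ h ⟩
      1ℚ                   ∎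

  -- Downward induction on the index, `j` being its distance to `Δ`. The two bounds need each other:
  -- the next coefficient being at most 1 gives nonnegativity, and its being nonnegative gives the
  -- upper bound through `c-rec`.
  c-bounds′ : ∀ j i → suc i ℕ.+ j ≡ Δ → 0ℚ ≤ℚ c Δ (suc i) × fromℕ (suc i) * c Δ (suc i) ≤ℚ 1ℚ
  c-bounds′ zero i e with refl ← trans (sym e) (ℕ.+-identityʳ (suc i)) rewrite c-last =
    ℚ.nonNegative⁻¹ (inv (suc i)) {{inv-nonNeg (suc i)}} , ℚ.≤-reflexive (fromℕ-*-inv i)
  c-bounds′ (suc j) i e = nonneg , upper
    where
    e′ : suc (suc i) ℕ.+ j ≡ Δ
    e′ = trans (cong suc (sym (ℕ.+-suc i j))) e
    i<Δ : suc i < Δ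
    i<Δ = subst (suc i <_) e′ (ℕ.m≤m+n _ j)
    ih = c-bounds′ j (suc i) e′
    c′ = c Δ (suc (suc i))
    0≤1-c : 0ℚ ≤ℚ 1ℚ - c′
    0≤1-c = begin
      0ℚ        ≡⟨ ℚ.+-inverseʳ c′ ⟨
      c′ - c′   ≤⟨ ℚ.+-monoˡ-≤ (- c′) (≤-from-multiple {suc i} (proj₁ ih) (proj₂ ih)) ⟩
      1ℚ - c′   ∎
    nonneg : 0ℚ ≤ℚ c Δ (suc i)
    nonneg = subst (0ℚ ≤ℚ_) (sym (c-step i<Δ))
      (ℚ.nonNegative⁻¹ ((1ℚ - c′) * inv (suc i)) {{ℚ.nonNeg*nonNeg⇒nonNeg (1ℚ - c′) {{nonNegative 0≤1-c}} (inv (suc i)) {{inv-nonNeg (suc i)}}}})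
    upper : fromℕ (suc i) * c Δ (suc i) ≤ℚ 1ℚ
    upper = begin
      fromℕ (suc i) * c Δ (suc i)        ≤⟨ p≤p+q (proj₁ ih) ⟩
      fromℕ (suc i) * c Δ (suc i) + c′   ≡⟨ c-rec i<Δ ⟩
      1ℚ                                 ∎

  module _ {i : ℕ} (i<Δ : i < Δ) where

    0≤c : 0ℚ ≤ℚ c Δ (suc i)
    0≤c = proj₁ (c-bounds′ (Δ ∸ suc i) i (ℕ.m+[n∸m]≡n i<Δ))

    i*c≤1 : fromℕ (suc i) * c Δ (suc i) ≤ℚ 1ℚ
    i*c≤1 = proj₂ (c-bounds′ (Δ ∸ suc i) i (ℕ.m+[n∸m]≡n i<Δ))

    c≤1 : c Δ (suc i) ≤ℚ 1ℚ
    c≤1 = ≤-from-multiple {i} 0≤c i*c≤1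

  -- With k = i + 1: (k + 1) c_{k+1} ≤ 1 = k c_k + c_{k+1}. Cancel c_{k+1} and divide by k.
  c-antitone : ∀ {i} → suc i < Δ → c Δ (suc (suc i)) ≤ℚ c Δ (suc i)
  c-antitone {i} i<Δ = ℚ.*-cancelˡ-≤-pos (fromℕ (suc i)) {{fromℕ-pos i}} (+-cancelʳ-≤ c′ (begin
    fromℕ (suc i) * c′ + c′            ≡⟨ fromℕ-suc-* (suc i) c′ ⟨
    fromℕ (suc (suc i)) * c′           ≤⟨ i*c≤1 i<Δ ⟩
    1ℚ                                 ≡⟨ c-rec i<Δ ⟨
    fromℕ (suc i) * c Δ (suc i) + c′   ∎))
    where c′ = c Δ (suc (suc i))

  -- Below `Δ`, replace c_{k+1} in the recurrence by the larger c_k. The index `Δ` has no successor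
  -- and uses c_Δ = 1/Δ.
  1≤[1+i]*c : ∀ {i} → i < Δ → 1ℚ ≤ℚ fromℕ (suc i) * c Δ (suc i) + c Δ (suc i)
  1≤[1+i]*c {i} i<Δ with ℕ.m≤n⇒m<n∨m≡n i<Δ
  ... | inj₁ i<Δ′ = begin
    1ℚ                                               ≡⟨ c-rec i<Δ′ ⟨
    fromℕ (suc i) * c Δ (suc i) + c Δ (suc (suc i))  ≤⟨ ℚ.+-monoʳ-≤ (fromℕ (suc i) * c Δ (suc i)) (c-antitone i<Δ′) ⟩
    fromℕ (suc i) * c Δ (suc i) + c Δ (suc i)        ∎
  ... | inj₂ refl = begin
    1ℚ                                               ≡⟨ fromℕ-*-inv i ⟨
    fromℕ (suc i) * inv (suc i)                      ≡⟨ cong (fromℕ (suc i) *_) c-last ⟨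
    fromℕ (suc i) * c Δ (suc i)                      ≤⟨ p≤p+q (0≤c i<Δ) ⟩
    fromℕ (suc i) * c Δ (suc i) + c Δ (suc i)        ∎

  -- With k = i + 1: k c_k + c_{k+1} = 1 ≤ (k + 1) c_{k+1} + c_{k+1}, so k c_k ≤ (k + 1) c_{k+1} ≤
  -- 2k c_{k+1}.
  c≤2c : ∀ {i} → suc i < Δ → c Δ (suc i) ≤ℚ c Δ (suc (suc i)) + c Δ (suc (suc i))
  c≤2c {i} i<Δ = ℚ.*-cancelˡ-≤-pos (fromℕ (suc i)) {{fromℕ-pos i}} (+-cancelʳ-≤ c′ (begin
    f * c Δ (suc i) + c′               ≡⟨ c-rec i<Δ ⟩
    1ℚ                                 ≤⟨ 1≤[1+i]*c i<Δ ⟩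
    fromℕ (suc (suc i)) * c′ + c′      ≡⟨ cong (_+ c′) (fromℕ-suc-* (suc i) c′) ⟩
    (f * c′ + c′) + c′                 ≤⟨ ℚ.+-monoˡ-≤ c′ (ℚ.+-monoʳ-≤ (f * c′) c′≤fc′) ⟩
    (f * c′ + f * c′) + c′             ≡⟨ cong (_+ c′) (ℚ.*-distribˡ-+ f c′ c′) ⟨
    f * (c′ + c′) + c′                 ∎))
    where
    f = fromℕ (suc i)
    c′ = c Δ (suc (suc i))
    c′≤fc′ : c′ ≤ℚ f * c′
    c′≤fc′ = begin
      c′         ≡⟨ ℚ.*-identityˡ c′ ⟨
      1ℚ * c′    ≤⟨ ℚ.*-monoʳ-≤-nonNeg c′ {{nonNegative (0≤c i<Δ)}} (fromℕ-mono {1} {suc i} (s≤s z≤n)) ⟩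
      f * c′     ∎

  -- With k = i + 1: by `c≤2c` the odd copy of c_k costs at most 2 c_{k+1}, and 2 (k c_k + c_{k+1})
  -- = 2.
  [2i+1]*c≤2 : ∀ {i} → suc i < Δ → fromℕ (suc i ℕ.+ suc (suc i)) * c Δ (suc i) ≤ℚ fromℕ 2
  [2i+1]*c≤2 {i} i<Δ = begin
    fromℕ (suc i ℕ.+ suc (suc i)) * q                  ≡⟨ cong (_* q) (fromℕ-+ (suc i) (suc (suc i))) ⟩
    (f + fromℕ (suc (suc i))) * q                      ≡⟨ ℚ.*-distribʳ-+ q f _ ⟩
    f * q + fromℕ (suc (suc i)) * q                    ≡⟨ cong (λ x → f * q + x) (fromℕ-suc-* (suc i) q) ⟩
    f * q + (f * q + q)                                ≤⟨ ℚ.+-monoʳ-≤ (f * q) (ℚ.+-monoʳ-≤ (f * q) (c≤2c i<Δ)) ⟩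
    f * q + (f * q + (c′ + c′))                        ≡⟨ solve 2 (λ a b → a :+ (a :+ (b :+ b)) := (a :+ b) :+ (a :+ b)) refl (f * q) c′ ⟩
    (f * q + c′) + (f * q + c′)                        ≡⟨ cong₂ _+_ (c-rec i<Δ) (c-rec i<Δ) ⟩
    fromℕ 2                                            ∎
    where
    open +-*-Solver
    f = fromℕ (suc i)
    q = c Δ (suc i)
    c′ = c Δ (suc (suc i))

-- Finite subsets as Boolean predicates

Sub : ℕ → Set
Sub k = Fin k → Bool

infix 4 _⊆_
_⊆_ : ∀ {k} → Sub k → Sub k → Set
P ⊆ Q = ∀ v → P v ≡ true → Q v ≡ true

full : ∀ {k} → Sub k
full _ = true

infix 5 _==_
_==_ : ∀ {k} → Fin k → Fin k → Bool
u == v = does (u ≟ v)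

==-refl : ∀ {k} (v : Fin k) → (v == v) ≡ true
==-refl v = dec-true (v ≟ v) refl

==-false : ∀ {k} {u v : Fin k} → u ≢ v → (u == v) ≡ false
==-false {u = u} {v} = dec-false (u ≟ v)

bool-absurd : {A : Set} {b : Bool} → b ≡ true → b ≡ false → A
bool-absurd {b = true} _ ()
bool-absurd {b = false} () _

∧-true : ∀ {a b} → a ∧ b ≡ true → a ≡ true × b ≡ true
∧-true {true} h = refl , h

not-true : ∀ {a} → not a ≡ true → a ≡ false
not-true {false} _ = refl

∨-false : ∀ {a b} → a ∨ b ≡ false → a ≡ false × b ≡ false
∨-false {false} h = refl , h

-- Cardinalities

count : ∀ {k} → Sub k → ℕ
count {zero}  P = 0
count {suc k} P = (if P zero then 1 else 0) ℕ.+ count (P ∘ suc)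

count-cong : ∀ {k} {P Q : Sub k} → (∀ v → P v ≡ Q v) → count P ≡ count Q
count-cong {zero}  h = refl
count-cong {suc k} h = cong₂ (λ b m → (if b then 1 else 0) ℕ.+ m) (h zero) (count-cong (h ∘ suc))

count-mono : ∀ {k} {P Q : Sub k} → P ⊆ Q → count P ≤ count Q
count-mono {zero} h = z≤n
count-mono {suc k} {P} {Q} h with P zero in p | Q zero in q
... | false | false = count-mono (h ∘ suc)
... | false | true  = ℕ.m≤n⇒m≤1+n (count-mono (h ∘ suc))
... | true  | true  = s≤s (count-mono (h ∘ suc))
... | true  | false = bool-absurd (h zero p) q

-- A position in `Q` only would force `P` to have more elements than `Q` among the remaining
-- positions. This yields the strict decrease under deletion, the presence of all neighbours in `S`,
-- and the completeness of the excluded graph.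
⊆-count-≥⇒⊇ : ∀ {k} {P Q : Sub k} → P ⊆ Q → count Q ≤ count P → Q ⊆ P
⊆-count-≥⇒⊇ {suc k} {P} {Q} h c≤ v qv with P zero in p | Q zero in q
⊆-count-≥⇒⊇ {suc k} h c≤ v qv | true | false = bool-absurd (h zero p) q
⊆-count-≥⇒⊇ {suc k} h c≤ v qv | false | true =
  ⊥-elim (ℕ.<⇒≱ c≤ (count-mono (h ∘ suc)))
⊆-count-≥⇒⊇ {suc k} h c≤ zero qv | true | true = p
⊆-count-≥⇒⊇ {suc k} h c≤ zero qv | false | false = bool-absurd qv q
⊆-count-≥⇒⊇ {suc k} h c≤ (suc v) qv | true | true = ⊆-count-≥⇒⊇ (h ∘ suc) (ℕ.s≤s⁻¹ c≤) v qv
⊆-count-≥⇒⊇ {suc k} h c≤ (suc v) qv | false | false = ⊆-count-≥⇒⊇ (h ∘ suc) c≤ v qv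

count-suc : ∀ {k} {P Q : Sub k} x → P x ≡ false → Q x ≡ true →
  (∀ v → v ≢ x → P v ≡ Q v) → count Q ≡ suc (count P)
count-suc zero p q h rewrite p | q = cong suc (count-cong (λ v → sym (h (suc v) (λ ()))))
count-suc {P = P} {Q} (suc x) p q h rewrite h zero (λ ()) =
  trans (cong ((if Q zero then 1 else 0) ℕ.+_) (count-suc x p q (λ v v≢x → h (suc v) λ { refl → v≢x refl })))
        (ℕ.+-suc (if Q zero then 1 else 0) _)

count-∅ : ∀ {k} → count {k} (λ _ → false) ≡ 0
count-∅ {zero}  = refl
count-∅ {suc k} = count-∅ {k}

count-full : ∀ {k} → count {k} full ≡ k
count-full {zero}  = refl
count-full {suc k} = cong suc (count-full {k})

length-filterᵇ-tabulate : ∀ {k} {A : Set} (P : A → Bool) (f : Fin k → A) →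
  length (filterᵇ P (tabulate f)) ≡ count (P ∘ f)
length-filterᵇ-tabulate {zero}  P f = refl
length-filterᵇ-tabulate {suc k} P f with P (f zero)
... | true  = cong suc (length-filterᵇ-tabulate P (f ∘ suc))
... | false = length-filterᵇ-tabulate P (f ∘ suc)

size-tabulate : ∀ {k} (P : Sub k) → size (Vec.tabulate P) ≡ count P
size-tabulate {zero}  P = refl
size-tabulate {suc k} P with P zero
... | true  = cong suc (size-tabulate (P ∘ suc))
... | false = size-tabulate (P ∘ suc)

argmin : ∀ {k} (S : Sub k) (f : Fin k → ℕ) {v : Fin k} → S v ≡ true →
  ∃ λ u → S u ≡ true × (∀ v → S v ≡ true → f u ≤ f v)
argmin {k} S f {v} v∈S = go (f v) v v∈S ℕ.≤-refl
  where
  -- `b` bounds the value of the current candidate and drops with each better one. If no value is at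
  -- most `b`, all are at least `suc b`, hence at least `f u`.
  go : ∀ b u → S u ≡ true → f u ≤ b → ∃ λ u → S u ≡ true × (∀ v → S v ≡ true → f u ≤ f v)
  go zero    u u∈S f≤0 = u , u∈S , λ v _ → ℕ.≤-trans f≤0 z≤n
  go (suc b) u u∈S f≤b with any? (λ v → S v ≟ᵇ true ×-dec f v ℕ.≤? b)
  ... | yes (v , v∈S , f≤) = go b v v∈S f≤
  ... | no none = u , u∈S , λ v v∈S → ℕ.≤-trans f≤b (ℕ.≰⇒> λ f≤ → none (v , v∈S , f≤))

-- Weighted sums

[_]_ : Bool → ℚ → ℚ
[ b ] q = if b then q else 0ℚ

sum-mono : ∀ {k} {f g : Fin k → ℚ} → (∀ v → f v ≤ℚ g v) → sum f ≤ℚ sum g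
sum-mono {zero}  h = ℚ.≤-refl
sum-mono {suc k} h = ℚ.+-mono-≤ (h zero) (sum-mono (h ∘ suc))

sum-indicator : ∀ {k} (P : Sub k) q → sum (λ v → [ P v ] q) ≡ fromℕ (count P) * q
sum-indicator {zero}  P q = sym (ℚ.*-zeroˡ q)
sum-indicator {suc k} P q with P zero
... | false = trans (ℚ.+-identityˡ _) (sum-indicator (P ∘ suc) q)
... | true  = trans (ℚ.+-comm q _) (trans (cong (_+ q) (sum-indicator (P ∘ suc) q)) (sym (fromℕ-suc-* (count (P ∘ suc)) q)))

sum-split : ∀ {k} (S P : Sub k) (w : Fin k → ℚ) →
  sum (λ v → [ S v ] w v) ≡ sum (λ v → [ S v ∧ P v ] w v) + sum (λ v → [ S v ∧ not (P v) ] w v)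
sum-split S P w = trans (sum-cong-≗ pointwise) (∑-distrib-+ (λ v → [ S v ∧ P v ] w v) (λ v → [ S v ∧ not (P v) ] w v))
  where
  pointwise : ∀ v → [ S v ] w v ≡ [ S v ∧ P v ] w v + [ S v ∧ not (P v) ] w v
  pointwise v with S v | P v
  ... | true  | true  = sym (ℚ.+-identityʳ (w v))
  ... | true  | false = sym (ℚ.+-identityˡ (w v))
  ... | false | _     = refl

sum-≤ : ∀ {k} (P : Sub k) (w : Fin k → ℚ) {a} → (∀ v → P v ≡ true → w v ≤ℚ a) →
  sum (λ v → [ P v ] w v) ≤ℚ fromℕ (count P) * a
sum-≤ P w {a} h = subst (sum (λ v → [ P v ] w v) ≤ℚ_) (sum-indicator P a) (sum-mono pointwise)
  where
  pointwise : ∀ v → [ P v ] w v ≤ℚ [ P v ] a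
  pointwise v with P v in p
  ... | true  = h v p
  ... | false = ℚ.≤-refl

-- Splitting off `x` leaves `m` elements of weight at most `a`. For `a = γ m` and `b = γ (suc m)`
-- the bound is the left side of `γ-rec`.
sum-≤-light : ∀ {k} (P : Sub k) (w : Fin k → ℚ) {a b m} x → P x ≡ true → count P ≡ suc m →
  (∀ v → P v ≡ true → w v ≤ℚ a) → w x ≤ℚ b →
  sum (λ v → [ P v ] w v) ≤ℚ fromℕ m * a + b
sum-≤-light {k} P w {a} {b} {m} x x∈P cP≡ wa wb = begin
  sum (λ v → [ P v ] w v)                              ≡⟨ sum-split P (_== x) w ⟩
  sum (λ v → [ P v ∧ (v == x) ] w v) + sum (λ v → [ P′ v ] w v)
                                                       ≤⟨ ℚ.+-mono-≤ (sum-≤ (λ v → P v ∧ (v == x)) w light) (sum-≤ P′ w λ v v∈ → wa v (proj₁ (∧-true v∈))) ⟩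
  fromℕ (count (λ v → P v ∧ (v == x))) * b + fromℕ (count P′) * a
                                                       ≡⟨ cong₂ (λ i j → fromℕ i * b + fromℕ j * a) count₁ count₂ ⟩
  1ℚ * b + fromℕ m * a                                 ≡⟨ solve 3 (λ b m a → con 1ℚ :* b :+ m :* a := m :* a :+ b) refl b (fromℕ m) a ⟩
  fromℕ m * a + b                                      ∎
  where
  open ℚ.≤-Reasoning
  open +-*-Solver
  P′ : Sub k
  P′ v = P v ∧ not (v == x)
  light : ∀ v → P v ∧ (v == x) ≡ true → w v ≤ℚ b
  light v v∈ with v ≟ x
  ... | yes refl = wb
  ... | no v≢x = bool-absurd (proj₂ (∧-true {P v} v∈)) refl
  count₁ : count (λ v → P v ∧ (v == x)) ≡ 1
  count₁ = trans (count-suc {P = λ _ → false} x refl (cong₂ _∧_ x∈P (==-refl x)) off) (cong suc (count-∅ {k}))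
    where
    off : ∀ v → v ≢ x → false ≡ P v ∧ (v == x)
    off v v≢x rewrite ==-false v≢x = sym (∧-zeroʳ (P v))
  count₂ : count P′ ≡ m
  count₂ = ℕ.suc-injective (trans (sym (count-suc {P = P′} x x∉P′ x∈P off)) cP≡)
    where
    x∉P′ : P′ x ≡ false
    x∉P′ rewrite ==-refl x = ∧-zeroʳ (P x)
    off : ∀ v → v ≢ x → P′ v ≡ P v
    off v v≢x rewrite ==-false v≢x = ∧-identityʳ (P v)

-- The independence number

allᵇ-true : {A : Set} {p : A → Bool} → (∀ x → p x ≡ true) → ∀ xs → allᵇ p xs ≡ true
allᵇ-true h []       = refl
allᵇ-true h (x ∷ xs) = cong₂ _∧_ (h x) (allᵇ-true h xs)

∈-allSubsets : ∀ {k} (S : Vec Bool k) → S ∈ allSubsets k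
∈-allSubsets []      = here refl
∈-allSubsets (b ∷ S) = ∈-concatMap⁺ (λ S → (true ∷ S) ∷ (false ∷ S) ∷ []) (Any.map (λ { refl → head b }) (∈-allSubsets S))
  where
  head : ∀ b → (b ∷ S) ∈ ((true ∷ S) ∷ (false ∷ S) ∷ [])
  head true  = here refl
  head false = there (here refl)

≤-maximum : {A : Set} (f : A → ℕ) {x : A} {xs : List A} → x ∈ xs → f x ≤ foldr ℕ._⊔_ 0 (map f xs)
≤-maximum f (here refl) = ℕ.m≤m⊔n _ _
≤-maximum f {xs = y ∷ _} (there x∈) = ℕ.≤-trans (≤-maximum f x∈) (ℕ.m≤n⊔m (f y) _)

module Independence (G : Graph) where

  Independent : Sub (n G) → Set
  Independent I = ∀ u v → I u ≡ true → I v ≡ true → adj G u v ≡ false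

  -- The indicator vector of `I` occurs in `allSubsets` and passes the Boolean test, so its size
  -- enters the maximum defining `α`.
  count≤α : ∀ {I} → Independent I → count I ≤ α G
  count≤α {I} indep = subst (_≤ α G)
    (trans (cong (λ b → if b then size S else 0) isIndep) (size-tabulate I))
    (≤-maximum (λ S → if isIndependent G S then size S else 0) (∈-allSubsets S))
    where
    S = Vec.tabulate I
    ok : ∀ u v → not (lookup S u ∧ lookup S v ∧ adj G u v) ≡ true
    ok u v rewrite lookup∘tabulate I u | lookup∘tabulate I v with I u in p | I v in q
    ... | true  | true  = cong not (indep u v p q)
    ... | true  | false = refl
    ... | false | _     = refl
    isIndep : isIndependent G S ≡ true
    isIndep = allᵇ-true (λ u → allᵇ-true (ok u) (allFin (n G))) (allFin (n G))

  -- Degrees and closed neighbourhoods inside a vertex subset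

  deg≡count : ∀ v → deg G v ≡ count (adj G v)
  deg≡count v = length-filterᵇ-tabulate (adj G v) (λ u → u)

  closed : Fin (n G) → Sub (n G)
  closed u v = (v == u) ∨ adj G u v

  infixl 6 _∖_
  _∖_ : Sub (n G) → Fin (n G) → Sub (n G)
  (S ∖ u) v = S v ∧ not (closed u v)

  degIn : Sub (n G) → Fin (n G) → ℕ
  degIn S u = count (λ v → S v ∧ adj G u v)

  closed-refl : ∀ u → closed u u ≡ true
  closed-refl u rewrite ==-refl u = refl

  count-closed : ∀ S u → S u ≡ true → count (λ v → S v ∧ closed u v) ≡ suc (degIn S u)
  count-closed S u u∈S = count-suc u (cong₂ _∧_ u∈S (adj-irrefl G u)) (cong₂ _∧_ u∈S (closed-refl u)) off
    where
    off : ∀ v → v ≢ u → S v ∧ adj G u v ≡ S v ∧ closed u v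
    off v v≢u rewrite ==-false v≢u = refl

  ∉-∖ : ∀ S u → (S ∖ u) u ≡ false
  ∉-∖ S u rewrite ==-refl u = ∧-zeroʳ (S u)

  count-∖ : ∀ S u → S u ≡ true → count (S ∖ u) < count S
  count-∖ S u u∈S = ℕ.≰⇒> λ ≥ →
    bool-absurd (⊆-count-≥⇒⊇ {P = S ∖ u} (λ v → proj₁ ∘ ∧-true) ≥ u u∈S) (∉-∖ S u)

  degIn≤deg : ∀ S u → degIn S u ≤ deg G u
  degIn≤deg S u = subst (degIn S u ≤_) (sym (deg≡count u)) (count-mono (λ v h → proj₂ (∧-true {S v} h)))

  -- The neighbours of `u` in `S` are among all its neighbours, and equal cardinality forces the two
  -- sets to agree.
  neighbours-inside : ∀ S u → deg G u ≤ degIn S u → ∀ v → adj G u v ≡ true → S v ≡ true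
  neighbours-inside S u d≤ v uv = proj₁ (∧-true
    (⊆-count-≥⇒⊇ {P = λ v → S v ∧ adj G u v} (λ v h → proj₂ (∧-true {S v} h)) (subst (_≤ degIn S u) (deg≡count u) d≤) v uv))

  -- The bound `q` is kept apart from the weight of `S`, so that two vertices can be added before
  -- any weights are compared.
  Solution : Sub (n G) → ℚ → Set
  Solution S q = ∃ λ I → I ⊆ S × Independent I × q ≤ℚ fromℕ (count I)

  -- Every neighbour of `u` has been deleted from `S ∖ u`, so `u` can join any independent set found
  -- there.
  extend : ∀ S u → S u ≡ true → ∀ {q} → Solution (S ∖ u) q → Solution S (1ℚ + q)
  extend S u u∈S {q} (I , I⊆ , indep , q≤) = J , J⊆S , J-indep , (begin
    1ℚ + q                     ≤⟨ ℚ.+-monoʳ-≤ 1ℚ q≤ ⟩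
    fromℕ 1 + fromℕ (count I)  ≡⟨ fromℕ-+ 1 (count I) ⟨
    fromℕ (suc (count I))      ≡⟨ cong fromℕ (count-suc u u∉I (cong (_∨ I u) (==-refl u)) off) ⟨
    fromℕ (count J)            ∎)
    where
    open ℚ.≤-Reasoning
    J : Sub (n G)
    J v = (v == u) ∨ I v
    u∉I : I u ≡ false
    u∉I with I u in e
    ... | false = refl
    ... | true  = bool-absurd (I⊆ u e) (∉-∖ S u)
    off : ∀ v → v ≢ u → I v ≡ J v
    off v v≢u rewrite ==-false v≢u = refl
    J⊆S : J ⊆ S
    J⊆S v v∈J with v ≟ u
    ... | yes refl = u∈S
    ... | no _     = proj₁ (∧-true (I⊆ v v∈J))
    nonadj : ∀ v → I v ≡ true → adj G u v ≡ false
    nonadj v v∈I = proj₂ (∨-false {v == u} (not-true (proj₂ (∧-true {S v} (I⊆ v v∈I)))))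
    J-indep : Independent J
    J-indep a b a∈J b∈J with a ≟ u | b ≟ u
    ... | yes refl | yes refl = adj-irrefl G u
    ... | yes refl | no _     = nonadj b b∈J
    ... | no _     | yes refl = trans (adj-sym G a u) (nonadj a a∈J)
    ... | no _     | no _     = indep a b a∈J b∈J

  -- Along a path to y, as long as no heavy vertex is met, all neighbours stay in S and have minimum degree again.
  find-heavy : ∀ S {u y} → Reach G u y → S u ≡ true → (∀ v → S v ≡ true → degIn S u ≤ degIn S v) →
    S y ≡ false ⊎ degIn S u < deg G y →
    ∃ λ u′ → ∃ λ x → S u′ ≡ true × degIn S u′ ≡ degIn S u × S x ∧ closed u′ x ≡ true × degIn S u < deg G x
  find-heavy S {u} path u∈S min end with degIn S u ℕ.<? deg G u
  ... | yes m<d = u , u , u∈S , refl , cong₂ _∧_ u∈S (closed-refl u) , m<d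
  -- The path has ended at `y` with no heavy vertex met: `y` lies in `S` and is not heavy, against
  -- either end condition. The first serves proper subsets, the second irregular graphs.
  find-heavy S here u∈S min (inj₁ u∉S) | no _ = bool-absurd u∈S u∉S
  find-heavy S here u∈S min (inj₂ m<d) | no m≮d = ⊥-elim (m≮d m<d)
  find-heavy S {u} (step {w = w} uw path) u∈S min end | no m≮d with degIn S u ℕ.<? deg G w
  ... | yes m<d = u , w , u∈S , refl , cong₂ _∧_ w∈S w∈N , m<d
    where
    w∈S = neighbours-inside S u (ℕ.≮⇒≥ m≮d) w uw
    w∈N : closed u w ≡ true
    w∈N rewrite uw = ∨-zeroʳ (w == u)
  ... | no m≮dw = subst P (sym same)
          (find-heavy S path w∈S (λ v v∈S → subst (_≤ degIn S v) same (min v v∈S)) (subst (λ m → S _ ≡ false ⊎ m < deg G _) same end))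
    where
    w∈S = neighbours-inside S u (ℕ.≮⇒≥ m≮d) w uw
    -- `w` is not heavy, so its degree in `S` is at most that of `u`; minimality gives the converse.
    same : degIn S u ≡ degIn S w
    same = ℕ.≤-antisym (min w w∈S) (ℕ.≤-trans (degIn≤deg S w) (ℕ.≮⇒≥ m≮dw))
    P : ℕ → Set
    P m = ∃ λ u′ → ∃ λ x → S u′ ≡ true × degIn S u′ ≡ m × S x ∧ closed u′ x ≡ true × m < deg G x

-- Greedy deletion

-- The coefficients enter only through these four inequalities. `γ-rec` includes index 0, the case
-- of a chosen vertex isolated in the remaining set.
module Greedy (G : Graph) (D : ℕ) (inClass : InClass D G) (γ : ℕ → ℚ)
  (0≤γ : ∀ {i} → i ≤ D → 0ℚ ≤ℚ γ i)
  (γ-antitone : ∀ {i j} → i ≤ j → j ≤ D → γ j ≤ℚ γ i)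
  (γ-rec : ∀ {i} → i < D → fromℕ i * γ i + γ (suc i) ≤ℚ 1ℚ)
  (γ-regular : fromℕ (D ℕ.+ suc D) * γ D ≤ℚ fromℕ 2) where

  open Independence G
  open ℚ.≤-Reasoning

  private
    connected = proj₁ inClass
    deg≤D     = proj₁ (proj₁ (proj₂ inClass))

  weight : Sub (n G) → ℚ
  weight S = sum (λ v → [ S v ] γ (deg G v))

  closedIn : Sub (n G) → Fin (n G) → Sub (n G)
  closedIn S u v = S v ∧ closed u v

  weight-closed≤1 : ∀ S u x → S u ≡ true → (∀ v → S v ≡ true → degIn S u ≤ degIn S v) →
    closedIn S u x ≡ true → degIn S u < deg G x → weight (closedIn S u) ≤ℚ 1ℚ
  weight-closed≤1 S u x u∈S min x∈N heavy = begin
    weight (closedIn S u)      ≤⟨ sum-≤-light (closedIn S u) (γ ∘ deg G) x x∈N (count-closed S u u∈S) bound (γ-antitone heavy (deg≤D x)) ⟩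
    fromℕ m * γ m + γ (suc m)  ≤⟨ γ-rec (ℕ.≤-trans heavy (deg≤D x)) ⟩
    1ℚ                         ∎
    where
    m = degIn S u
    -- The degree in `G` is at least the degree in `S`, which is at least `m` by minimality.
    bound : ∀ v → closedIn S u v ≡ true → γ (deg G v) ≤ℚ γ m
    bound v v∈N = γ-antitone (ℕ.≤-trans (min v (proj₁ (∧-true v∈N))) (degIn≤deg S v)) (deg≤D v)

  weaken : ∀ {S p q} → p ≤ℚ q → Solution S q → Solution S p
  weaken p≤q (I , I⊆S , indep , q≤) = I , I⊆S , indep , ℚ.≤-trans p≤q q≤

  add-vertex : ∀ S u → S u ≡ true → weight (closedIn S u) ≤ℚ 1ℚ →
    Solution (S ∖ u) (weight (S ∖ u)) → Solution S (weight S)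
  add-vertex S u u∈S light sol = weaken le (extend S u u∈S sol)
    where
    le : weight S ≤ℚ 1ℚ + weight (S ∖ u)
    le = begin
      weight S                                        ≡⟨ sum-split S (closed u) (γ ∘ deg G) ⟩
      weight (closedIn S u) + weight (S ∖ u)      ≤⟨ ℚ.+-monoˡ-≤ (weight (S ∖ u)) light ⟩
      1ℚ + weight (S ∖ u)                         ∎

  -- Induction on the bound `b` for the size. The missing vertex `y` is the target of the path given
  -- to `find-heavy`; after the deletion `u` takes this role.
  solve-proper′ : ∀ b S → count S ≤ b → ∀ y → S y ≡ false → Solution S (weight S)
  solve-proper′ b S cS≤ y y∉S with any? (λ v → S v ≟ᵇ true)
  -- `S` is empty and solves itself; the weight bound 1 holds vacuously.
  ... | no empty = S , (λ _ h → h) , (λ u _ u∈ _ → ⊥-elim (empty (u , u∈))) , (begin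
    weight S                 ≤⟨ sum-≤ S (γ ∘ deg G) {1ℚ} (λ v v∈ → ⊥-elim (empty (v , v∈))) ⟩
    fromℕ (count S) * 1ℚ     ≡⟨ ℚ.*-identityʳ _ ⟩
    fromℕ (count S)          ∎)
  solve-proper′ zero S cS≤ y y∉S | yes (v , v∈S) = ⊥-elim (ℕ.<⇒≱ (count-∖ S v v∈S) (ℕ.≤-trans cS≤ z≤n))
  solve-proper′ (suc b) S cS≤ y y∉S | yes (v , v∈S)
    with u₀ , u₀∈S , min ← argmin S (degIn S) v∈S
    with u , x , u∈S , e , x∈N , heavy ← find-heavy S (connected u₀ y) u₀∈S min (inj₁ y∉S)
    -- Turns minimality and heaviness from statements about `u₀` into statements about `u`.
    rewrite sym e
    = add-vertex S u u∈S (weight-closed≤1 S u x u∈S min x∈N heavy)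
        (solve-proper′ b (S ∖ u) (ℕ.s≤s⁻¹ (ℕ.≤-trans (count-∖ S u u∈S) cS≤)) u (∉-∖ S u))

  solve-proper : ∀ S y → S y ≡ false → Solution S (weight S)
  solve-proper S = solve-proper′ (count S) S ℕ.≤-refl

  -- The minimum degree is at most `deg G u`, so `y` is heavy and can end the path for `find-heavy`.
  -- After one deletion the set is proper.
  solve-irregular : ∀ u y → deg G u < deg G y → Solution full (weight full)
  solve-irregular u y u<y
    with u₀ , _ , min ← argmin full (degIn full) {u} refl
    with u₁ , x , _ , e , x∈N , heavy ← find-heavy full (connected u₀ y) refl min
           (inj₂ (ℕ.≤-trans (s≤s (ℕ.≤-trans (min u refl) (degIn≤deg full u))) u<y))
    rewrite sym e
    = add-vertex full u₁ refl (weight-closed≤1 full u₁ x refl min x∈N heavy)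
        (solve-proper (full ∖ u₁) u₁ (∉-∖ full u₁))

  -- Two greedy steps remove at most (D + 1) + D vertices, since the second chosen vertex has already lost a neighbour.
  solve-regular : (∀ v → deg G v ≡ D) → Fin (n G) → Solution full (weight full)
  solve-regular regular u with any? (λ v → (full ∖ u) v ≟ᵇ true)
  -- Here the closed neighbourhood of `u` is everything, so there are `D + 1` vertices and
  -- regularity makes the graph complete.
  ... | no empty = ⊥-elim (proj₂ (proj₂ inClass) (n≡ , complete))
    where
    count-N : ∀ v → count (closed v) ≡ suc D
    count-N v = trans (count-closed full v refl) (cong suc (trans (sym (deg≡count v)) (regular v)))
    N-full : ∀ v → closed u v ≡ true
    N-full v with closed u v in e
    ... | true  = refl
    ... | false = ⊥-elim (empty (v , cong not e))
    n≡ : n G ≡ suc D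
    n≡ = trans (sym count-full) (trans (count-cong (sym ∘ N-full)) (count-N u))
    complete : ∀ a b → a ≢ b → adj G a b ≡ true
    -- `closed a` has as many elements as there are vertices, so it contains `b`; as `b` differs
    -- from `a`, only adjacency remains.
    complete a b a≢b = subst (λ t → t ∨ adj G a b ≡ true) (==-false (a≢b ∘ sym))
      (⊆-count-≥⇒⊇ {P = closed a} {Q = full} (λ _ _ → refl)
        (ℕ.≤-reflexive (trans count-full (trans n≡ (sym (count-N a))))) b refl)
  ... | yes (v , v∈S)
    with u₀ , u₀∈S , min ← argmin (full ∖ u) (degIn (full ∖ u)) v∈S
    with u′ , x , u′∈S , e , x∈N , heavy ← find-heavy (full ∖ u) (connected u₀ u) u₀∈S min (inj₁ (∉-∖ full u))
    rewrite sym e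
    = weaken le (extend full u refl (extend S u′ u′∈S (solve-proper S′ u′ (∉-∖ S u′))))
    where
    S  = full ∖ u
    S′ = S ∖ u′
    bound : ∀ P → weight P ≤ℚ fromℕ (count P) * γ D
    bound P = sum-≤ P (γ ∘ deg G) (λ v _ → ℚ.≤-reflexive (cong γ (regular v)))
    0≤γD = 0≤γ ℕ.≤-refl
    c₁≤ : count (closed u) ≤ suc D
    c₁≤ = subst (_≤ suc D) (sym (count-closed full u refl))
            (s≤s (ℕ.≤-trans (degIn≤deg full u) (deg≤D u)))
    -- `heavy` puts the degree of `u′` in `S` strictly below `deg G x ≤ D`, which saves one vertex
    -- compared with `c₁≤`.
    c₂≤ : count (closedIn S u′) ≤ D
    c₂≤ = subst (_≤ D) (sym (count-closed S u′ u′∈S)) (ℕ.≤-trans heavy (deg≤D x))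
    two : weight (closed u) + weight (closedIn S u′) ≤ℚ fromℕ 2
    two = begin
      weight (closed u) + weight (closedIn S u′)        ≤⟨ ℚ.+-mono-≤ (bound (closed u)) (bound (closedIn S u′)) ⟩
      fromℕ a * γ D + fromℕ b * γ D                       ≡⟨ ℚ.*-distribʳ-+ (γ D) (fromℕ a) (fromℕ b) ⟨
      (fromℕ a + fromℕ b) * γ D                           ≡⟨ cong (_* γ D) (fromℕ-+ a b) ⟨
      fromℕ (a ℕ.+ b) * γ D                               ≤⟨ ℚ.*-monoʳ-≤-nonNeg (γ D) {{nonNegative 0≤γD}} (fromℕ-mono (subst (a ℕ.+ b ≤_) (ℕ.+-comm (suc D) D) (ℕ.+-mono-≤ c₁≤ c₂≤))) ⟩
      fromℕ (D ℕ.+ suc D) * γ D                           ≤⟨ γ-regular ⟩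
      fromℕ 2                                             ∎
      where
      a = count (closed u)
      b = count (closedIn S u′)
    le : weight full ≤ℚ 1ℚ + (1ℚ + weight S′)
    le = begin
      weight full                                                    ≡⟨ sum-split full (closed u) (γ ∘ deg G) ⟩
      weight (closed u) + weight S                                 ≡⟨ cong (λ q → weight (closed u) + q) (sum-split S (closed u′) (γ ∘ deg G)) ⟩
      weight (closed u) + (weight (closedIn S u′) + weight S′)     ≡⟨ ℚ.+-assoc (weight (closed u)) _ _ ⟨
      weight (closed u) + weight (closedIn S u′) + weight S′       ≤⟨ ℚ.+-monoˡ-≤ (weight S′) two ⟩
      fromℕ 2 + weight S′                                            ≡⟨ ℚ.+-assoc 1ℚ 1ℚ (weight S′) ⟩
      1ℚ + (1ℚ + weight S′)                                          ∎

  solve-full : Solution full (weight full)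
  solve-full with proj₂ (proj₁ (proj₂ inClass))
  ... | y , dy≡D with any? (λ u → deg G u ℕ.<? D)
  ...   | yes (u , u<D) = solve-irregular u y (subst (deg G u <_) (sym dy≡D) u<D)
  ...   | no none = solve-regular (λ v → ℕ.≤-antisym (deg≤D v) (ℕ.≮⇒≥ λ v<D → none (v , v<D))) y

  weight≤α : sum (γ ∘ deg G) ≤ℚ fromℕ (α G)
  weight≤α with I , _ , indep , w≤ ← solve-full = ℚ.≤-trans w≤ (fromℕ-mono (count≤α indep))

-- From degree classes to single vertices, and the conclusion

weightedSum≤sum : ∀ {Δ} m (G : Graph) (γ : ℕ → ℚ) → (∀ i → i < m → γ (suc i) ≡ c Δ (suc i)) → (∀ v → 0ℚ ≤ℚ γ (deg G v)) →
  weightedSum Δ m G ≤ℚ sum (λ v → [ deg G v ≤ᵇ m ] γ (deg G v))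
weightedSum≤sum {Δ} zero G γ γ≡c 0≤γ =
  -- The 0 on the left is written as a sum of zeros, to be compared termwise with the nonnegative
  -- weights of the vertices of degree 0.
  subst (_≤ℚ sum (λ v → [ deg G v ≤ᵇ 0 ] γ (deg G v))) (trans (sum-indicator {n G} (λ _ → false) 0ℚ) (ℚ.*-zeroʳ (fromℕ (count {n G} (λ _ → false))))) (sum-mono nonneg)
  where
  nonneg : ∀ v → 0ℚ ≤ℚ [ deg G v ≤ᵇ 0 ] γ (deg G v)
  nonneg v with deg G v ≤ᵇ 0
  ... | true  = 0≤γ v
  ... | false = ℚ.≤-refl
weightedSum≤sum {Δ} (suc m) G γ γ≡c 0≤γ = begin
  weightedSum Δ m G + c Δ (suc m) * fromℕ (numDeg G (suc m))
    ≤⟨ ℚ.+-monoˡ-≤ (c Δ (suc m) * fromℕ (numDeg G (suc m))) (weightedSum≤sum m G γ (λ i i<m → γ≡c i (ℕ.m≤n⇒m≤1+n i<m)) 0≤γ) ⟩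
  sum lower + c Δ (suc m) * fromℕ (numDeg G (suc m))
    ≡⟨ cong (λ q → sum lower + q) (trans (ℚ.*-comm (c Δ (suc m)) _) (cong (λ k → fromℕ k * c Δ (suc m)) (length-filterᵇ-tabulate (λ v → deg G v ≡ᵇ suc m) (λ v → v)))) ⟩
  sum lower + fromℕ (count (λ v → deg G v ≡ᵇ suc m)) * c Δ (suc m)
    ≡⟨ cong (λ q → sum lower + q) (sum-indicator (λ v → deg G v ≡ᵇ suc m) (c Δ (suc m))) ⟨
  sum lower + sum top
    ≡⟨ ∑-distrib-+ lower top ⟨
  sum (λ v → lower v + top v)
    ≡⟨ sum-cong-≗ (λ v → merge (deg G v)) ⟩
  sum (λ v → [ deg G v ≤ᵇ suc m ] γ (deg G v)) ∎
  where
  open ℚ.≤-Reasoning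
  lower top : Fin (n G) → ℚ
  lower v = [ deg G v ≤ᵇ m ] γ (deg G v)
  top v = [ deg G v ≡ᵇ suc m ] c Δ (suc m)
  merge : ∀ k → [ k ≤ᵇ m ] γ k + [ k ≡ᵇ suc m ] c Δ (suc m) ≡ [ k ≤ᵇ suc m ] γ k
  merge k with k ℕ.≟ suc m
  ... | yes refl rewrite dec-false (suc m ℕ.≤? m) (ℕ.<-irrefl refl) | dec-true (m ℕ.≟ m) refl
                       | dec-true (suc m ℕ.≤? suc m) ℕ.≤-refl =
    trans (ℚ.+-identityˡ (c Δ (suc m))) (sym (γ≡c m ℕ.≤-refl))
  ... | no k≢ rewrite dec-false (k ℕ.≟ suc m) k≢ with k ℕ.≤? m
  ...   | yes k≤m rewrite dec-true (k ℕ.≤? m) k≤m | dec-true (k ℕ.≤? suc m) (ℕ.m≤n⇒m≤1+n k≤m) = ℚ.+-identityʳ (γ k)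
  ...   | no k≰m rewrite dec-false (k ℕ.≤? m) k≰m
                       | dec-false (k ℕ.≤? suc m) (λ k≤ → k≢ (ℕ.≤-antisym k≤ (ℕ.≰⇒> k≰m))) = refl

-- Degree 0 does not occur in the weighted sum; the value 1 keeps the coefficients antitone.
extended : ℕ → ℕ → ℚ
extended Δ zero    = 1ℚ
extended Δ (suc i) = c Δ (suc i)

module Extended (Δ : ℕ) where

  open Coefficients Δ

  0≤extended : ∀ {i} → i ≤ Δ → 0ℚ ≤ℚ extended Δ i
  0≤extended {zero}  _   = 0≤fromℕ 1
  0≤extended {suc i} i<Δ = 0≤c i<Δ

  extended-step : ∀ {i} → i < Δ → extended Δ (suc i) ≤ℚ extended Δ i
  extended-step {zero}  0<Δ = c≤1 0<Δ
  extended-step {suc i} i<Δ = c-antitone i<Δ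

  extended-antitone : ∀ {i j} → i ≤ j → j ≤ Δ → extended Δ j ≤ℚ extended Δ i
  extended-antitone {i} {j} i≤j j≤Δ with ℕ.m≤n⇒m<n∨m≡n i≤j
  ... | inj₂ refl = ℚ.≤-refl
  extended-antitone {i} {suc j} _ j<Δ | inj₁ (s≤s i≤j) =
    ℚ.≤-trans (extended-step j<Δ) (extended-antitone i≤j (ℕ.<⇒≤ j<Δ))

  -- At index 0 the product vanishes and c_1 ≤ 1 suffices; elsewhere this is `c-rec`, with equality.
  extended-rec : ∀ {i} → i < Δ → fromℕ i * extended Δ i + extended Δ (suc i) ≤ℚ 1ℚ
  extended-rec {zero}  0<Δ = subst (_≤ℚ 1ℚ) (sym (ℚ.+-identityˡ (c Δ 1))) (c≤1 0<Δ)
  extended-rec {suc i} i<Δ = ℚ.≤-reflexive (c-rec i<Δ)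

theorem4 : (Δ : ℕ) → 4 ≤ Δ → (Δ' : ℕ) → 3 ≤ Δ' → Δ' < Δ →
    (G : Graph) → InClass Δ' G →
    weightedSum Δ Δ' G ≤ℚ fromℕ (α G)
theorem4 Δ _ Δ'@(suc _) _ Δ'<Δ G inClass = begin
  weightedSum Δ Δ' G                                   ≤⟨ weightedSum≤sum Δ' G γ (λ _ _ → refl) 0≤γ ⟩
  sum (λ v → [ deg G v ≤ᵇ Δ' ] γ (deg G v))            ≤⟨ sum-mono (λ v → indicator≤ (deg G v ≤ᵇ Δ') (0≤γ v)) ⟩
  sum (λ v → γ (deg G v))                              ≤⟨ weight≤α ⟩
  fromℕ (α G)                                          ∎
  where
  open ℚ.≤-Reasoning
  open Extended Δ
  γ = extended Δ
  Δ'≤Δ = ℕ.<⇒≤ Δ'<Δ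
  -- The strict inequality `Δ' < Δ` makes the coefficient of index Δ' + 1 available, with which
  -- `[2i+1]*c≤2` compares that of index Δ'.
  open Greedy G Δ' inClass γ (λ i≤ → 0≤extended (ℕ.≤-trans i≤ Δ'≤Δ))
    (λ i≤j j≤ → extended-antitone i≤j (ℕ.≤-trans j≤ Δ'≤Δ))
    (λ i< → extended-rec (ℕ.<-trans i< Δ'<Δ)) (Coefficients.[2i+1]*c≤2 Δ Δ'<Δ)
  0≤γ : ∀ v → 0ℚ ≤ℚ γ (deg G v)
  0≤γ v = 0≤extended (ℕ.≤-trans (proj₁ (proj₁ (proj₂ inClass)) v) Δ'≤Δ)
  indicator≤ : ∀ b {q} → 0ℚ ≤ℚ q → [ b ] q ≤ℚ q
  indicator≤ true  _   = ℚ.≤-refl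
  indicator≤ false 0≤q = 0≤q
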